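{- For $n\ge0$ let $F_n(x)=\sum_{\pi\in\mathcal{S}_n}x^{\mathrm{lbsum}(\pi)}$. Then $F_0(x)=1$ and, for all $n\ge1$, $$F_n(x)=\sum_{k=1}^n\binom{n-1}{k-1}F_{k-1}(x)\,F_{n-k}(x)\,x^{k(n-k)}.$$
   Context: $\mathcal{S}_n$ is the set of permutations $\pi=\pi_1\cdots\pi_n$ of $\{1,\ldots,n\}$. The left border number $a_i$ of $\pi$ is the largest position $m<i$ with $\pi_m>\pi_i$, or $0$ if no such position exists, and $\mathrm{lbsum}(\pi)=a_1+\cdots+a_n$. -}

module Defs where

open import Algebra.Bundles using (CommutativeSemiring)
open import Data.Fin.Base using (Fin; toℕ)
open import Data.Fin.Properties using (_≟_; _<?_)
open import Data.List.Base as List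
  using (List; []; _∷_; allFin; applyUpTo; cartesianProductWith; filter)
open import Data.List.Extrema.Nat using (max)
open import Data.Nat.Base using (ℕ; zero; suc)
open import Data.Vec.Base using (Vec; []; _∷_; lookup; sum; tabulate)
open import Data.Vec.Relation.Unary.AllPairs using (allPairs?)
open import Data.Vec.Relation.Unary.Unique.Propositional using (Unique)
open import Relation.Nullary.Decidable using (¬?; _×-dec_)
open import Relation.Unary using (Decidable)

-- Every word of length m over the alphabet Fin n, each listed exactly once.
words : ∀ n m → List (Vec (Fin n) m)
words n zero    = [] ∷ []
words n (suc m) = cartesianProductWith _∷_ (allFin n) (words n m)

unique? : ∀ {n m} → Decidable (Unique {A = Fin n} {m})
unique? = allPairs? λ a b → ¬? (a ≟ b)

-- One-line notation, with the letters 1 < ⋯ < n represented by the elements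
-- of Fin n in the same order; a word of length n over n letters is a
-- permutation iff its letters are pairwise distinct.
𝒮 : ∀ n → List (Vec (Fin n) n)
𝒮 n = filter unique? (words n n)

-- Indices in Fin n count from 0, so index m is position suc (toℕ m); the value
-- 0 is returned exactly when no larger letter precedes position i.
leftBorder : ∀ {n} → Vec (Fin n) n → Fin n → ℕ
leftBorder {n} π i =
  max 0 (List.map (λ m → suc (toℕ m))
    (filter (λ m → (m <? i) ×-dec (lookup π i <? lookup π m)) (allFin n)))

lbsum : ∀ {n} → Vec (Fin n) n → ℕ
lbsum π = sum (tabulate (leftBorder π))

-- The list 1, 2, …, n.
[1⋯_] : ℕ → List ℕ
[1⋯ n ] = applyUpTo suc n

-- F n x is the value of the polynomial at an element x of an arbitrary
-- commutative semiring; the polynomial itself is the case where x is the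
-- indeterminate of ℕ[x].
module Polynomials {c ℓ} (R : CommutativeSemiring c ℓ) where
  open CommutativeSemiring R public
    using (Carrier; _≈_; _+_; _*_; 0#; 1#)
  open import Algebra.Properties.Semiring.Exp
    (CommutativeSemiring.semiring R) public using (_^_)
  open import Algebra.Properties.Semiring.Mult
    (CommutativeSemiring.semiring R) public using () renaming (_×_ to _·_)

  ∑ : ∀ {a} {A : Set a} → List A → (A → Carrier) → Carrier
  ∑ xs f = List.foldr _+_ 0# (List.map f xs)

  infix 5 ∑
  syntax ∑ xs (λ i → e) = ∑[ i ∈ xs ] e

  F : ℕ → Carrier → Carrier
  F n x = ∑[ π ∈ 𝒮 n ] (x ^ lbsum π)

{-# OPTIONS --safe #-}
-- Every arrangement of a set of letters with maximum m is α m β for a unique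
-- ordered partition of the remaining letters into the letter sets of α and β. As m
-- exceeds every other letter, it has left border 0 and the borders inside α are
-- unchanged, while the border of each letter of β grows by ∣α∣ + 1: it is either m
-- or a letter of β shifted to its position in the whole word. Hence
-- lbsum (α m β) = lbsum α + lbsum β + (∣α∣ + 1) ∣β∣, and there are
-- (n-1 choose k-1) ordered partitions of the other letters with ∣α∣ = k - 1.
module Submission where

open import Defs
open import Algebra.Bundles using (CommutativeSemiring)
open import Data.Nat.Base as ℕ using (ℕ; _∸_; _≥_)
open import Data.Nat.Combinatorics using (_C_)
open import Data.Product.Base using (_×_)

open import Data.Bool.Base using (true; false; if_then_else_; T)
open import Data.Fin.Base as Fin using (Fin; toℕ; fromℕ<)
open import Data.Fin.Properties as Fin using (_<?_; toℕ-injective; toℕ-fromℕ<; toℕ<n; injective⇒≤)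
open import Data.List.Base as List
  using (List; []; _∷_; [_]; _++_; _ʳ++_; map; length; filter; concatMap; downFrom; upTo; allFin)
open import Data.List.Extrema.Nat using (max; max[xs]≤max[ys]⁺)
open import Data.List.Membership.Propositional using (_∈_; _∉_; find)
open import Data.List.Membership.Propositional.Properties
open import Data.List.Membership.Propositional.Properties.WithK using (unique∧set⇒bag)
import Data.List.Properties as List
open import Data.List.Relation.Binary.BagAndSetEquality using (∼bag⇒↭)
open import Data.List.Relation.Binary.Permutation.Propositional
  using (_↭_; ↭-refl; ↭-sym; ↭-trans; prep; ↭⇒↭ₛ; ↭⇒↭ₛ′)
open import Data.List.Relation.Binary.Permutation.Propositional.Properties
  using (All-resp-↭; ∈-resp-↭; ↭-reverse; ↭-length; shift; drop-mid; ↭-empty-inv; map⁺)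
import Data.List.Relation.Binary.Permutation.Setoid.Properties as ↭ₛ
open import Data.List.Relation.Binary.Sublist.Propositional using (_⊆_; []; _∷ʳ_; _∷_)
open import Data.List.Relation.Binary.Sublist.Propositional.Properties using (All-resp-⊆; length-mono-≤)
open import Data.List.Relation.Unary.All as All using (All; []; _∷_)
import Data.List.Relation.Unary.All.Properties as All
open import Data.List.Relation.Unary.AllPairs as AllPairs using (AllPairs; []; _∷_)
import Data.List.Relation.Unary.AllPairs.Properties as AllPairs
open import Data.List.Relation.Unary.Any as Any using (here; there)
open import Data.List.Relation.Unary.Unique.Propositional using (Unique)
import Data.List.Relation.Unary.Unique.Propositional.Properties as Unique
open import Data.Nat.Base using (zero; suc; _<_; _≤_; _<ᵇ_; z≤n; s≤s)
open import Data.Nat.Combinatorics using (nCk+nC[k+1]≡[n+1]C[k+1]; k>n⇒nCk≡0)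
import Data.Nat.Properties as ℕ
open import Data.Product.Base using (∃; _,_; proj₁; proj₂)
open import Data.Sum.Base using (inj₁; inj₂)
open import Data.Vec.Base as Vec using (Vec; []; _∷_; lookup; tabulate)
import Data.Vec.Properties as Vec
import Data.Vec.Relation.Unary.All as VecAll
open import Data.Vec.Relation.Unary.AllPairs using ([]; _∷_)
import Data.Vec.Relation.Unary.Unique.Propositional as Vec
import Data.Vec.Relation.Unary.Unique.Propositional.Properties as VecUnique
open import Function.Base using (_∘_; id)
open import Function.Bundles using (mk⇔)
open import Level using (Level)
open import Relation.Binary.PropositionalEquality as ≡
  using (_≡_; refl; cong; cong₂; subst; module ≡-Reasoning)
open import Relation.Nullary using (does; yes; no; contradiction; _×-dec_)
open import Relation.Unary using (Pred; Decidable)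

private variable
  a p q : Level
  A B : Set a
  xs ys L : List A

-- Arrangements and unshuffles of a list

splits : List A → List (List A × List A)
splits []      = ([] , []) ∷ []
splits (c ∷ w) = ([] , c ∷ w) ∷ map (λ (α , β) → c ∷ α , β) (splits w)

∈-splits⁺ : (α β : List A) → (α , β) ∈ splits (α ++ β)
∈-splits⁺ []      []      = here refl
∈-splits⁺ []      (c ∷ β) = here refl
∈-splits⁺ (c ∷ α) β       = there (∈-map⁺ _ (∈-splits⁺ α β))

∈-splits⁻ : ∀ {α β w : List A} → (α , β) ∈ splits w → α ++ β ≡ w
∈-splits⁻ {w = []}    (here refl) = refl
∈-splits⁻ {w = c ∷ w} (here refl) = refl
∈-splits⁻ {w = c ∷ w} (there s) with _ , s′ , refl ← ∈-map⁻ _ s = cong (c ∷_) (∈-splits⁻ s′)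

insertions : A → List A → List (List A)
insertions m w = map (λ (α , β) → α ++ m ∷ β) (splits w)

permutations : List A → List (List A)
permutations []      = [ [] ]
permutations (m ∷ L) = concatMap (insertions m) (permutations L)

∈-insertions⁻ : ∀ {m : A} {v w} → v ∈ insertions m w →
                ∃ λ α → ∃ λ β → w ≡ α ++ β × v ≡ α ++ m ∷ β
∈-insertions⁻ v∈ with (α , β) , s , eq ← ∈-map⁻ _ v∈ = α , β , ≡.sym (∈-splits⁻ s) , eq

∈-permutations⁻ : ∀ {w L : List A} → w ∈ permutations L → w ↭ L
∈-permutations⁻ {L = []}    (here refl) = ↭-refl
∈-permutations⁻ {L = m ∷ L} w∈
  with _ , v∈ , w∈′ ← find (∈-concatMap⁻ (insertions m) {permutations L} w∈)
  with α , β , refl , refl ← ∈-insertions⁻ w∈′ =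
  ↭-trans (shift m α β) (prep m (∈-permutations⁻ v∈))

-- The letter `m` must occur somewhere in `w`. Deleting that occurrence leaves an arrangement of
-- `L`, and `w` is recovered by inserting `m` at the same place.
∈-permutations⁺ : ∀ {w L : List A} → w ↭ L → w ∈ permutations L
∈-permutations⁺ {L = []}    w↭ with refl ← ↭-empty-inv w↭ = here refl
∈-permutations⁺ {L = m ∷ L} w↭ with α , β , refl ← ∈-∃++ (∈-resp-↭ (↭-sym w↭) (here refl)) =
  ∈-concatMap⁺ (insertions m) {permutations L}
    (Any.map (λ {v} eq → subst (λ v → _ ∈ insertions m v) eq (∈-map⁺ _ (∈-splits⁺ α β)))
      (∈-permutations⁺ {L = L} (drop-mid α [] w↭)))

-- If the two displayed occurrences of `m` stood at different positions, the earlier one would lie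
-- in the left part of the other word, where `m` is absent.
++-∷-injective : ∀ {m : A} {α β α′ β′} → m ∉ α ++ β → m ∉ α′ ++ β′ →
                 α ++ m ∷ β ≡ α′ ++ m ∷ β′ → α ++ β ≡ α′ ++ β′
++-∷-injective {α = []}    {α′ = []}     _ _ refl = refl
++-∷-injective {α = []}    {α′ = _ ∷ _}  _ m∉ refl = contradiction (here refl) m∉
++-∷-injective {α = _ ∷ _} {α′ = []}     m∉ _ refl = contradiction (here refl) m∉
++-∷-injective {α = c ∷ α} {α′ = _ ∷ α′} m∉ m∉′ eq with refl , eq′ ← List.∷-injective eq =
  cong (c ∷_) (++-∷-injective {α = α} {α′ = α′} (m∉ ∘ there) (m∉′ ∘ there) eq′)

-- Insertion in front gives a word that begins with `m`. All other insertions begin with `c`, which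
-- differs from `m`, and they are told apart by their tails.
insertions-unique : ∀ {m : A} {w} → m ∉ w → Unique (insertions m w)
insertions-unique {w = []}    _ = [] ∷ []
insertions-unique {m = m} {w = c ∷ w} m∉ =
  All.tabulate (λ { v∈ refl → head≢ v∈ }) ∷
  subst Unique tail≡ (Unique.map⁺ List.∷-injectiveʳ (insertions-unique (m∉ ∘ there)))
  where
  tail≡ : map (c ∷_) (insertions m w) ≡ map _ (map _ (splits w))
  tail≡ = ≡.trans (≡.sym (List.map-∘ (splits w))) (List.map-∘ (splits w))
  head≢ : m ∷ c ∷ w ∉ map (λ (α , β) → α ++ m ∷ β) (map _ (splits w))
  head≢ v∈ with _ , _ , eq ← ∈-map⁻ _ (subst (_ ∈_) (≡.sym tail≡) v∈) =
    m∉ (here (List.∷-injectiveˡ eq))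

concatMap-unique : ∀ {f : A → List B} → (∀ {x} → x ∈ xs → Unique (f x)) →
  (∀ {x y z} → x ∈ xs → y ∈ xs → z ∈ f x → z ∈ f y → x ≡ y) →
  Unique xs → Unique (concatMap f xs)
concatMap-unique {xs = []} _ _ _ = []
concatMap-unique {xs = x ∷ xs} {f = f} u inj (x∉ ∷ xs!) =
  Unique.++⁺ (u (here refl))
    (concatMap-unique (u ∘ there) (λ y∈ z∈ → inj (there y∈) (there z∈)) xs!)
    λ (z∈ , z∈′) → let y , y∈ , z∈fy = find (∈-concatMap⁻ f {xs} z∈′) in
      All.lookup x∉ y∈ (inj (here refl) (there y∈) z∈ z∈fy)

-- Deleting `m` from an arrangement recovers the word into which it was inserted, so different
-- arrangements of `L` produce disjoint lists of insertions.
permutations-unique : Unique L → Unique (permutations L)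
permutations-unique []         = [] ∷ []
permutations-unique {L = m ∷ L} (m∉ ∷ L!) =
  concatMap-unique (insertions-unique ∘ fresh)
    (λ v∈ w∈ u∈ u∈′ → inj (fresh v∈) (fresh w∈) u∈ u∈′)
    (permutations-unique L!)
  where
  fresh : ∀ {w} → w ∈ permutations L → m ∉ w
  fresh w∈ m∈ = All.lookup m∉ (∈-resp-↭ (∈-permutations⁻ w∈) m∈) refl
  inj : ∀ {u v w} → m ∉ v → m ∉ w → u ∈ insertions m v → u ∈ insertions m w → v ≡ w
  inj m∉v m∉w u∈ u∈′
    with α , _ , refl , refl ← ∈-insertions⁻ u∈
    with α′ , _ , refl , eq ← ∈-insertions⁻ u∈′ = ++-∷-injective {α = α} {α′ = α′} m∉v m∉w eq

-- These are the ordered partitions of the entries of `L` into two classes. Each class keeps the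
-- order of `L`, so the halves of a decreasing list are again decreasing.
unshuffles : List A → List (List A × List A)
unshuffles []      = [ [] , [] ]
unshuffles (m ∷ L) = map (λ (α , β) → m ∷ α , β) (unshuffles L) ++
                     map (λ (α , β) → α , m ∷ β) (unshuffles L)

∈-unshuffles⁻ : ∀ {α β L : List A} → (α , β) ∈ unshuffles L → α ⊆ L × β ⊆ L
∈-unshuffles⁻ {L = []}    (here refl) = [] , []
∈-unshuffles⁻ {L = m ∷ L} s with ∈-++⁻ (map _ (unshuffles L)) s
... | inj₁ s′ with _ , s″ , refl ← ∈-map⁻ _ s′ with α⊆ , β⊆ ← ∈-unshuffles⁻ s″ =
  refl ∷ α⊆ , m ∷ʳ β⊆
... | inj₂ s′ with _ , s″ , refl ← ∈-map⁻ _ s′ with α⊆ , β⊆ ← ∈-unshuffles⁻ s″ =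
  m ∷ʳ α⊆ , refl ∷ β⊆

AllPairs-resp-⊆ : ∀ {r} {R : A → A → Set r} → xs ⊆ ys → AllPairs R ys → AllPairs R xs
AllPairs-resp-⊆ []          []         = []
AllPairs-resp-⊆ (_ ∷ʳ xs⊆)  (_ ∷ ys)   = AllPairs-resp-⊆ xs⊆ ys
AllPairs-resp-⊆ (refl ∷ xs⊆) (y ∷ ys) = All-resp-⊆ xs⊆ y ∷ AllPairs-resp-⊆ xs⊆ ys

-- Left borders by searching a reversed prefix

-- The prefix p preceding the letter c is stored backwards, so that the search
-- for the nearest larger letter starts at its head.
border : ℕ → List ℕ → ℕ
border c []      = 0
border c (d ∷ p) = if c <ᵇ d then suc (length p) else border c p

borderSum : List ℕ → List ℕ → ℕ
borderSum p []      = 0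
borderSum p (c ∷ w) = border c p ℕ.+ borderSum (c ∷ p) w

borderSum-++ : ∀ p α β → borderSum p (α ++ β) ≡ borderSum p α ℕ.+ borderSum (α ʳ++ p) β
borderSum-++ p []      β = refl
borderSum-++ p (c ∷ α) β =
  ≡.trans (cong (border c p ℕ.+_) (borderSum-++ (c ∷ p) α β)) (≡.sym (ℕ.+-assoc (border c p) _ _))

border-≤-length : ∀ c p → border c p ≤ length p
border-≤-length c []      = z≤n
border-≤-length c (d ∷ p) with c <ᵇ d
... | true  = ℕ.≤-refl
... | false = ℕ.m≤n⇒m≤1+n (border-≤-length c p)

-- The search either stops inside `p`, at a letter whose position is now counted with `m` and `q`
-- before it, or runs through `p` and stops at `m`. In the second case `border c p` is 0, and the
-- shift `suc (length q)` is itself the position of `m`.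
border-++-∷ : ∀ {c m} → c < m → ∀ p q → border c (p ++ m ∷ q) ≡ border c p ℕ.+ suc (length q)
border-++-∷ {c} {m} c<m [] q with c <ᵇ m | ℕ.<⇒<ᵇ c<m
... | true | _ = refl
border-++-∷ {c} c<m (d ∷ p) q with c <ᵇ d
... | true  = cong suc (List.length-++ p)
... | false = border-++-∷ c<m p q

border-max : ∀ {m p} → All (_< m) p → border m p ≡ 0
border-max []                     = refl
border-max {m} {d ∷ p} (d<m ∷ p<m) with m <ᵇ d in eq
... | true  = contradiction (ℕ.<ᵇ⇒< m d (subst T (≡.sym eq) _)) (ℕ.<-asym d<m)
... | false = border-max p<m

-- Every letter of `w` gains the same amount by `border-++-∷`. The part `p` collects the letters of
-- `w` already read, which lie between `m` and the current letter.
borderSum-shift : ∀ {m w} → All (_< m) w → ∀ p q →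
  borderSum (p ++ m ∷ q) w ≡ borderSum p w ℕ.+ suc (length q) ℕ.* length w
borderSum-shift {w = []} [] p q = ≡.sym (ℕ.*-zeroʳ (suc (length q)))
borderSum-shift {w = c ∷ w} (c<m ∷ w<m) p q = begin
  border c (p ++ _ ∷ q) ℕ.+ borderSum (c ∷ p ++ _ ∷ q) w
    ≡⟨ cong₂ ℕ._+_ (border-++-∷ c<m p q) (borderSum-shift w<m (c ∷ p) q) ⟩
  (border c p ℕ.+ s) ℕ.+ (borderSum (c ∷ p) w ℕ.+ s ℕ.* length w)
    ≡⟨ interchange (border c p) s _ _ ⟩
  (border c p ℕ.+ borderSum (c ∷ p) w) ℕ.+ (s ℕ.+ s ℕ.* length w)
    ≡⟨ cong (border c p ℕ.+ borderSum (c ∷ p) w ℕ.+_) (ℕ.*-suc s (length w)) ⟨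
  (border c p ℕ.+ borderSum (c ∷ p) w) ℕ.+ s ℕ.* suc (length w) ∎
  where
  open ≡-Reasoning
  open import Algebra.Properties.CommutativeSemigroup ℕ.+-commutativeSemigroup using (interchange)
  s = suc (length q)

borderSum-max : ∀ {m α β} → All (_< m) α → All (_< m) β →
  borderSum [] (α ++ m ∷ β) ≡
    borderSum [] α ℕ.+ borderSum [] β ℕ.+ suc (length α) ℕ.* length β
borderSum-max {m} {α} {β} α<m β<m = begin
  borderSum [] (α ++ m ∷ β)
    ≡⟨ borderSum-++ [] α (m ∷ β) ⟩
  borderSum [] α ℕ.+ (border m αʳ ℕ.+ borderSum (m ∷ αʳ) β)
    ≡⟨ cong (λ b → borderSum [] α ℕ.+ (b ℕ.+ borderSum (m ∷ αʳ) β)) (border-max (All-resp-↭ (↭-sym (↭-reverse α)) α<m)) ⟩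
  borderSum [] α ℕ.+ borderSum (m ∷ αʳ) β
    ≡⟨ cong (borderSum [] α ℕ.+_) (borderSum-shift β<m [] αʳ) ⟩
  borderSum [] α ℕ.+ (borderSum [] β ℕ.+ suc (length αʳ) ℕ.* length β)
    ≡⟨ cong (λ l → borderSum [] α ℕ.+ (borderSum [] β ℕ.+ suc l ℕ.* length β)) (List.length-reverse α) ⟩
  borderSum [] α ℕ.+ (borderSum [] β ℕ.+ suc (length α) ℕ.* length β)
    ≡⟨ ℕ.+-assoc (borderSum [] α) _ _ ⟨
  borderSum [] α ℕ.+ borderSum [] β ℕ.+ suc (length α) ℕ.* length β ∎
  where
  open ≡-Reasoning
  αʳ = α ʳ++ []

-- Agreement of `lbsum` with `borderSum`

letters : ∀ {n m} → Vec (Fin n) m → List ℕ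
letters []      = []
letters (c ∷ v) = toℕ c ∷ letters v

-- Used when a letter moves from the word into the prefix: its position, as the first candidate,
-- then supersedes the default value of `max`.
max-∷ : ∀ {b z} → b ≤ z → ∀ xs → max b (z ∷ xs) ≡ max z xs
max-∷ {b} {z} b≤z xs = ℕ.≤-antisym
  (max[xs]≤max[ys]⁺ z xs (inj₁ b≤z) (inj₁ ℕ.≤-refl ∷ All.tabulate (inj₂ ∘ Any.map ℕ.≤-reflexive)))
  (max[xs]≤max[ys]⁺ b (z ∷ xs) (inj₂ (here ℕ.≤-refl)) (All.tabulate (inj₂ ∘ there ∘ Any.map ℕ.≤-reflexive)))

map-filter-cong : ∀ {c} {C : Set c} {P : Pred B p} {Q : Pred A q} (P? : Decidable P) (Q? : Decidable Q)
  {f : B → C} {g : A → C} {h : A → B} →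
  (∀ x → does (P? (h x)) ≡ does (Q? x)) → (∀ x → f (h x) ≡ g x) →
  ∀ xs → map f (filter P? (map h xs)) ≡ map g (filter Q? xs)
map-filter-cong P? Q? {h = h} P≡Q f≡g []       = refl
map-filter-cong P? Q? {h = h} P≡Q f≡g (x ∷ xs) with does (P? (h x)) | does (Q? x) | P≡Q x
... | true  | true  | refl = cong₂ _∷_ (f≡g x) (map-filter-cong P? Q? P≡Q f≡g xs)
... | false | false | refl = map-filter-cong P? Q? P≡Q f≡g xs

module _ {N : ℕ} where

  Larger : ∀ {n} (v : Vec (Fin N) n) (i m : Fin n) → Set
  Larger v i m = m Fin.< i × lookup v i Fin.< lookup v m

  larger? : ∀ {n} (v : Vec (Fin N) n) i → Decidable (Larger v i)
  larger? v i m = (m <? i) ×-dec (lookup v i <? lookup v m)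

  -- leftBorder for a word that continues the reversed prefix p.
  leftBorderAfter : ∀ {n} → List ℕ → Vec (Fin N) n → Fin n → ℕ
  leftBorderAfter {n} p v i = max (border (toℕ (lookup v i)) p)
    (map (λ m → suc (length p) ℕ.+ toℕ m) (filter (larger? v i) (allFin n)))

  -- Removing the first letter lowers every later index by one; the larger offset keeps the
  -- positions in the whole word the same.
  filter-allFin : ∀ {n} (c : Fin N) (v : Vec (Fin N) n) i k →
    map (λ m → k ℕ.+ toℕ m) (filter (larger? (c ∷ v) (Fin.suc i)) (List.tabulate Fin.suc)) ≡
    map (λ m → suc k ℕ.+ toℕ m) (filter (larger? v i) (allFin n))
  filter-allFin {n} c v i k = ≡.trans
    (cong (map (λ m → k ℕ.+ toℕ m) ∘ filter (larger? (c ∷ v) (Fin.suc i))) (≡.sym (List.map-tabulate id Fin.suc)))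
    (map-filter-cong (larger? (c ∷ v) (Fin.suc i)) (larger? v i)
      (λ _ → refl) (λ m → ℕ.+-suc k (toℕ m)) (allFin n))

  leftBorderAfter-zero : ∀ {n} p c (v : Vec (Fin N) n) →
    leftBorderAfter p (c ∷ v) Fin.zero ≡ border (toℕ c) p
  leftBorderAfter-zero {n} p c v =
    cong (max (border (toℕ c) p) ∘ map _)
      (List.filter-none (larger? (c ∷ v) Fin.zero) {xs = allFin (suc n)} (All.tabulate λ _ ()))

  -- Position zero of `c ∷ v` passes the filter under the same comparison that `border` makes at the
  -- head of `toℕ c ∷ p`. If it fails, both sides go on with `p`; if it succeeds, its position is at
  -- least any border found in `p` and becomes the default.
  leftBorderAfter-suc : ∀ {n} p c (v : Vec (Fin N) n) i →
    leftBorderAfter p (c ∷ v) (Fin.suc i) ≡ leftBorderAfter (toℕ c ∷ p) v i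
  leftBorderAfter-suc p c v i with toℕ (lookup v i) <ᵇ toℕ c
  ... | false = cong (max (border (toℕ (lookup v i)) p)) (filter-allFin c v i (suc (length p)))
  -- The candidate at index zero has the value `suc (length p) + 0`, which must become
  -- `suc (length p)`.
  ... | true  rewrite ℕ.+-identityʳ (length p) = ≡.trans
    (max-∷ (ℕ.m≤n⇒m≤1+n (border-≤-length (toℕ (lookup v i)) p))
      (map (λ m → suc (length p) ℕ.+ toℕ m)
        (filter (larger? (c ∷ v) (Fin.suc i)) (List.tabulate Fin.suc))))
    (cong (max (suc (length p))) (filter-allFin c v i (suc (length p))))

  sum-leftBorderAfter : ∀ {n} p (v : Vec (Fin N) n) →
    Vec.sum (tabulate (leftBorderAfter p v)) ≡ borderSum p (letters v)
  sum-leftBorderAfter p []      = refl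
  sum-leftBorderAfter p (c ∷ v) = cong₂ ℕ._+_ (leftBorderAfter-zero p c v)
    (≡.trans (cong Vec.sum (Vec.tabulate-cong (leftBorderAfter-suc p c v)))
      (sum-leftBorderAfter (toℕ c ∷ p) v))

-- For the empty prefix the default is 0 and the offset is 1, so `leftBorderAfter []` unfolds to
-- `leftBorder`.
lbsum-letters : ∀ {n} (π : Vec (Fin n) n) → lbsum π ≡ borderSum [] (letters π)
lbsum-letters = sum-leftBorderAfter []

-- Permutations in one-line notation as arrangements of `downFrom n`

∈-words : ∀ {n m} (v : Vec (Fin n) m) → v ∈ words n m
∈-words []      = here refl
∈-words (c ∷ v) = ∈-cartesianProductWith⁺ _∷_ (∈-allFin c) (∈-words v)

words-unique : ∀ n m → Unique (words n m)
words-unique n zero    = [] ∷ []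
words-unique n (suc m) =
  Unique.cartesianProductWith⁺ _∷_ Vec.∷-injective (Unique.allFin⁺ n) (words-unique n m)

letters-injective : ∀ {n m} {u v : Vec (Fin n) m} → letters u ≡ letters v → u ≡ v
letters-injective {u = []}    {[]}    _  = refl
letters-injective {u = _ ∷ _} {_ ∷ _} eq with c≡d , u≡v ← List.∷-injective eq =
  cong₂ _∷_ (toℕ-injective c≡d) (letters-injective u≡v)

length-letters : ∀ {n m} (v : Vec (Fin n) m) → length (letters v) ≡ m
length-letters []      = refl
length-letters (c ∷ v) = cong suc (length-letters v)

All-letters⁺ : ∀ {n m} {P : Pred ℕ p} {v : Vec (Fin n) m} →
               VecAll.All (P ∘ toℕ) v → All P (letters v)
All-letters⁺ VecAll.[]         = []
All-letters⁺ (pc VecAll.∷ pv) = pc ∷ All-letters⁺ pv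

All-letters⁻ : ∀ {n m} {P : Pred ℕ p} {v : Vec (Fin n) m} →
               All P (letters v) → VecAll.All (P ∘ toℕ) v
All-letters⁻ {v = []}    []        = VecAll.[]
All-letters⁻ {v = _ ∷ _} (pc ∷ pv) = pc VecAll.∷ All-letters⁻ pv

Unique-letters⁺ : ∀ {n m} {v : Vec (Fin n) m} → Vec.Unique v → Unique (letters v)
Unique-letters⁺ []        = []
Unique-letters⁺ (c∉ ∷ v!) =
  All-letters⁺ (VecAll.map (λ c≢d → c≢d ∘ toℕ-injective) c∉) ∷ Unique-letters⁺ v!

Unique-letters⁻ : ∀ {n m} {v : Vec (Fin n) m} → Unique (letters v) → Vec.Unique v
Unique-letters⁻ {v = []}    []        = []
Unique-letters⁻ {v = _ ∷ _} (c∉ ∷ v!) =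
  VecAll.map (λ c≢d → c≢d ∘ cong toℕ) (All-letters⁻ c∉) ∷ Unique-letters⁻ v!

letters-surjective : ∀ {n w} → All (_< n) w → ∃ λ (v : Vec (Fin n) (length w)) → letters v ≡ w
letters-surjective []          = [] , refl
letters-surjective (c<n ∷ w<n) with v , eq ← letters-surjective w<n =
  fromℕ< c<n ∷ v , cong₂ _∷_ (toℕ-fromℕ< c<n) eq

-- Otherwise c could be prepended, giving n + 1 distinct letters out of n.
unique⇒∈-letters : ∀ {n} {π : Vec (Fin n) n} → Vec.Unique π → ∀ c → toℕ c ∈ letters π
unique⇒∈-letters {n} {π} π! c with toℕ c ∈? letters π
  where open import Data.List.Membership.DecPropositional ℕ._≟_ using (_∈?_)
... | yes c∈ = c∈
... | no  c∉ = contradiction (injective⇒≤ (VecUnique.lookup-injective cπ! _ _)) ℕ.1+n≰n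
  where
  cπ! : Vec.Unique (c ∷ π)
  cπ! = Unique-letters⁻ (All.¬Any⇒All¬ _ c∉ ∷ Unique-letters⁺ π!)

letters<n : ∀ {n m} (v : Vec (Fin n) m) → All (_< n) (letters v)
letters<n []      = []
letters<n (c ∷ v) = toℕ<n c ∷ letters<n v

-- Two lists without repetitions are rearrangements of each other once they have the same members;
-- one inclusion is the bound on the letters, the other the pigeonhole principle. The order of
-- `downFrom` puts the maximum at the head, where the recursion takes it off.
letters-↭-downFrom : ∀ {n} {π : Vec (Fin n) n} → Vec.Unique π → letters π ↭ downFrom n
letters-↭-downFrom {n} {π} π! = ∼bag⇒↭ (unique∧set⇒bag (Unique-letters⁺ π!) (Unique.downFrom⁺ n)
  (mk⇔ (∈-downFrom⁺ ∘ All.lookup (letters<n π))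
       λ c∈ → let c<n = ∈-downFrom⁻ c∈ in
         subst (_∈ letters π) (toℕ-fromℕ< c<n) (unique⇒∈-letters π! (fromℕ< c<n))))

↭-downFrom⇒letters : ∀ {n w} → w ↭ downFrom n →
                     ∃ λ (π : Vec (Fin n) n) → Vec.Unique π × letters π ≡ w
-- The preimage of `w` is a vector of length `length w`; that length has to be transported to `n`.
↭-downFrom⇒letters {n} {w} w↭ = subst P (≡.trans (↭-length w↭) (List.length-downFrom n))
  let v , eq = letters-surjective (All-resp-↭ (↭-sym w↭) (All.tabulate ∈-downFrom⁻))
  in v , Unique-letters⁻ (subst Unique (≡.sym eq) w!) , eq
  where
  P : ℕ → Set
  P m = ∃ λ (v : Vec (Fin n) m) → Vec.Unique v × letters v ≡ w
  w! : Unique w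
  w! = ↭ₛ.Unique-resp-↭ (≡.setoid ℕ) (↭⇒↭ₛ (↭-sym w↭)) (Unique.downFrom⁺ n)

-- Neither list has repetitions, so equal membership already gives equal multisets, which is all
-- that a sum depends on.
letters-𝒮-↭ : ∀ n → map letters (𝒮 n) ↭ permutations (downFrom n)
letters-𝒮-↭ n = ∼bag⇒↭ (unique∧set⇒bag
  (Unique.map⁺ letters-injective (Unique.filter⁺ unique? (words-unique n n)))
  (permutations-unique (Unique.downFrom⁺ n))
  (mk⇔ to from))
  where
  to : ∀ {w} → w ∈ map letters (𝒮 n) → w ∈ permutations (downFrom n)
  to w∈ with π , π∈ , refl ← ∈-map⁻ letters w∈ =
    ∈-permutations⁺ (letters-↭-downFrom (∈-filter⁻ unique? {xs = words n n} π∈ .proj₂))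
  from : ∀ {w} → w ∈ permutations (downFrom n) → w ∈ map letters (𝒮 n)
  from w∈ with π , π! , eq ← ↭-downFrom⇒letters (∈-permutations⁻ w∈) =
    subst (_∈ map letters (𝒮 n)) eq (∈-map⁺ letters (∈-filter⁺ unique? (∈-words π) π!))

-- Finite sums in a commutative semiring

module Sums {c ℓ} (R : CommutativeSemiring c ℓ) where
  open CommutativeSemiring R hiding (_≈_; _+_; _*_; 0#; 1#; Carrier; refl)
  open CommutativeSemiring R using () renaming (refl to ≈-refl)
  open Polynomials R
  open import Algebra.Properties.CommutativeSemigroup +-commutativeSemigroup using (interchange; x∙yz≈y∙xz)
  open import Algebra.Properties.Semiring.Mult semiring using (×-homo-+; ×-congˡ)
  open import Relation.Binary.Reasoning.Setoid setoid

  ∑-cong : ∀ ys {f g : A → Carrier} → (∀ {y} → y ∈ ys → f y ≈ g y) → ∑ ys f ≈ ∑ ys g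
  ∑-cong []       f≈g = ≈-refl
  ∑-cong (y ∷ ys) f≈g = +-cong (f≈g (here refl)) (∑-cong ys (f≈g ∘ there))

  ∑-map : ∀ (h : A → B) ys (f : B → Carrier) → ∑ (map h ys) f ≡ ∑ ys (f ∘ h)
  ∑-map h ys f = cong (List.foldr _+_ 0#) (≡.sym (List.map-∘ ys))

  ∑-++ : ∀ xs ys (f : A → Carrier) → ∑ (xs ++ ys) f ≈ ∑ xs f + ∑ ys f
  ∑-++ []       ys f = sym (+-identityˡ _)
  ∑-++ (x ∷ xs) ys f = trans (+-congˡ (∑-++ xs ys f)) (sym (+-assoc _ _ _))

  ∑-concatMap : ∀ (h : A → List B) ys (f : B → Carrier) →
                ∑ (concatMap h ys) f ≈ ∑[ y ∈ ys ] ∑ (h y) f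
  ∑-concatMap h []       f = ≈-refl
  ∑-concatMap h (y ∷ ys) f = trans (∑-++ (h y) _ f) (+-congˡ (∑-concatMap h ys f))

  ∑-+ : ∀ ys (f g : A → Carrier) → ∑[ y ∈ ys ] (f y + g y) ≈ ∑ ys f + ∑ ys g
  ∑-+ []       f g = sym (+-identityˡ 0#)
  ∑-+ (y ∷ ys) f g = trans (+-congˡ (∑-+ ys f g)) (interchange _ _ _ _)

  ∑-*ˡ : ∀ ys (a : Carrier) (f : A → Carrier) → ∑[ y ∈ ys ] (a * f y) ≈ a * ∑ ys f
  ∑-*ˡ []       a f = sym (zeroʳ a)
  ∑-*ˡ (y ∷ ys) a f = trans (+-congˡ (∑-*ˡ ys a f)) (sym (distribˡ a _ _))

  ∑-*ʳ : ∀ ys (f : A → Carrier) (a : Carrier) → ∑[ y ∈ ys ] (f y * a) ≈ ∑ ys f * a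
  ∑-*ʳ []       f a = sym (zeroˡ a)
  ∑-*ʳ (y ∷ ys) f a = trans (+-congˡ (∑-*ʳ ys f a)) (sym (distribʳ a _ _))

  ∑-↭ : xs ↭ ys → ∀ (f : A → Carrier) → ∑ xs f ≈ ∑ ys f
  ∑-↭ xs↭ys f = ↭ₛ.foldr-commMonoid setoid +-isCommutativeMonoid
    (↭⇒↭ₛ′ isEquivalence (map⁺ f xs↭ys))

  ∑-∷ʳ : ∀ ys y (f : A → Carrier) → ∑ (ys List.∷ʳ y) f ≈ ∑ ys f + f y
  ∑-∷ʳ ys y f = trans (∑-++ ys [ y ] f) (+-congˡ (+-identityʳ (f y)))

  ∑-0 : ∀ (ys : List A) → ∑[ y ∈ ys ] 0# ≈ 0#
  ∑-0 []       = ≈-refl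
  ∑-0 (y ∷ ys) = trans (+-identityˡ _) (∑-0 ys)

  ∑-comm : ∀ xs ys (f : B → A → Carrier) →
           ∑[ x ∈ xs ] ∑[ y ∈ ys ] f y x ≈ ∑[ y ∈ ys ] ∑[ x ∈ xs ] f y x
  ∑-comm []       ys f = sym (∑-0 ys)
  ∑-comm (x ∷ xs) ys f = trans (+-congˡ (∑-comm xs ys f)) (sym (∑-+ ys (λ y → f y x) _))

  ∑-upTo-suc : ∀ n (f : ℕ → Carrier) → ∑ (upTo (suc n)) f ≡ f 0 + ∑ (upTo n) (f ∘ suc)
  ∑-upTo-suc n f = cong (f 0 +_) (≡.trans
    (cong (λ ks → ∑ ks f) (≡.sym (List.map-upTo suc n))) (∑-map suc (upTo n) f))

  -- Sums over insertions, splits and unshuffles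

  ∑-insertions : ∀ (m : A) w (f : List A → Carrier) →
    ∑ (insertions m w) f ≈ ∑[ s ∈ splits w ] f (s .proj₁ ++ m ∷ s .proj₂)
  ∑-insertions m w f = reflexive (∑-map _ (splits w) f)

  ∑-permutations-∷ : ∀ (m : A) L (f : List A → Carrier) →
    ∑ (permutations (m ∷ L)) f ≈
    ∑[ w ∈ permutations L ] ∑[ s ∈ splits w ] f (s .proj₁ ++ m ∷ s .proj₂)
  ∑-permutations-∷ m L f = trans (∑-concatMap (insertions m) (permutations L) f)
    (∑-cong (permutations L) λ {w} _ → ∑-insertions m w f)

  ∑-splits-∷ : ∀ (m : A) w (g : List A → List A → Carrier) →
    ∑[ s ∈ splits (m ∷ w) ] g (s .proj₁) (s .proj₂) ≈
    g [] (m ∷ w) + (∑[ s ∈ splits w ] g (m ∷ s .proj₁) (s .proj₂))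
  ∑-splits-∷ m w g = +-congˡ (reflexive (∑-map _ (splits w) _))

  -- A cut of the word falls either before `m`, and then cuts `α`, or after `m`, and then cuts `β`.
  ∑-splits-++ : ∀ (m : A) α β (g : List A → List A → Carrier) →
    ∑[ s ∈ splits (α ++ m ∷ β) ] g (s .proj₁) (s .proj₂) ≈
    (∑[ s ∈ splits α ] g (s .proj₁) (s .proj₂ ++ m ∷ β)) +
    (∑[ s ∈ splits β ] g (α ++ m ∷ s .proj₁) (s .proj₂))
  ∑-splits-++ m []      β g = trans (∑-splits-∷ m β g) (+-congʳ (sym (+-identityʳ _)))
  ∑-splits-++ m (c ∷ α) β g = begin
    (∑[ s ∈ splits (c ∷ α ++ m ∷ β) ] g (s .proj₁) (s .proj₂))
      ≈⟨ ∑-splits-∷ c (α ++ m ∷ β) g ⟩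
    g [] (c ∷ α ++ m ∷ β) + (∑[ s ∈ splits (α ++ m ∷ β) ] g (c ∷ s .proj₁) (s .proj₂))
      ≈⟨ +-congˡ (∑-splits-++ m α β (g ∘ (c ∷_))) ⟩
    g [] (c ∷ α ++ m ∷ β) +
      ((∑[ s ∈ splits α ] g (c ∷ s .proj₁) (s .proj₂ ++ m ∷ β)) + _)
      ≈⟨ +-assoc _ _ _ ⟨
    (g [] (c ∷ α ++ m ∷ β) + (∑[ s ∈ splits α ] g (c ∷ s .proj₁) (s .proj₂ ++ m ∷ β))) + _
      ≈⟨ +-congʳ (∑-splits-∷ c α λ α′ α″ → g α′ (α″ ++ m ∷ β)) ⟨
    (∑[ s ∈ splits (c ∷ α) ] g (s .proj₁) (s .proj₂ ++ m ∷ β)) +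
    (∑[ s ∈ splits β ] g (c ∷ α ++ m ∷ s .proj₁) (s .proj₂)) ∎

  -- Both sides run over the ways to cut `w` into three consecutive pieces; they differ in which of
  -- the two cuts is made first.
  ∑-splits-assoc : ∀ (w : List A) (g : List A → List A → List A → Carrier) →
    ∑[ s ∈ splits w ] ∑[ t ∈ splits (s .proj₁) ] g (t .proj₁) (t .proj₂) (s .proj₂) ≈
    ∑[ s ∈ splits w ] ∑[ t ∈ splits (s .proj₂) ] g (s .proj₁) (t .proj₁) (t .proj₂)
  ∑-splits-assoc []      g = ≈-refl
  ∑-splits-assoc (c ∷ w) g = begin
    (∑[ s ∈ splits (c ∷ w) ] ∑[ t ∈ splits (s .proj₁) ] g (t .proj₁) (t .proj₂) (s .proj₂))
      ≈⟨ ∑-splits-∷ c w (λ α β → ∑[ t ∈ splits α ] g (t .proj₁) (t .proj₂) β) ⟩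
    (g [] [] (c ∷ w) + 0#) +
      (∑[ s ∈ splits w ] ∑[ t ∈ splits (c ∷ s .proj₁) ] g (t .proj₁) (t .proj₂) (s .proj₂))
      ≈⟨ +-cong (+-identityʳ _)
           (∑-cong (splits w) λ {s} _ → ∑-splits-∷ c (s .proj₁) (λ α α′ → g α α′ (s .proj₂))) ⟩
    g [] [] (c ∷ w) +
      (∑[ s ∈ splits w ] (g [] (c ∷ s .proj₁) (s .proj₂) +
        (∑[ t ∈ splits (s .proj₁) ] g (c ∷ t .proj₁) (t .proj₂) (s .proj₂))))
      ≈⟨ +-congˡ (∑-+ (splits w) _ _) ⟩
    g [] [] (c ∷ w) +
      ((∑[ s ∈ splits w ] g [] (c ∷ s .proj₁) (s .proj₂)) +
       (∑[ s ∈ splits w ] ∑[ t ∈ splits (s .proj₁) ] g (c ∷ t .proj₁) (t .proj₂) (s .proj₂)))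
      ≈⟨ +-congˡ (+-congˡ (∑-splits-assoc w (g ∘ (c ∷_)))) ⟩
    g [] [] (c ∷ w) +
      ((∑[ s ∈ splits w ] g [] (c ∷ s .proj₁) (s .proj₂)) +
       (∑[ s ∈ splits w ] ∑[ t ∈ splits (s .proj₂) ] g (c ∷ s .proj₁) (t .proj₁) (t .proj₂)))
      ≈⟨ +-assoc _ _ _ ⟨
    (g [] [] (c ∷ w) + (∑[ s ∈ splits w ] g [] (c ∷ s .proj₁) (s .proj₂))) +
      (∑[ s ∈ splits w ] ∑[ t ∈ splits (s .proj₂) ] g (c ∷ s .proj₁) (t .proj₁) (t .proj₂))
      ≈⟨ +-congʳ (∑-splits-∷ c w (g [])) ⟨
    (∑[ t ∈ splits (c ∷ w) ] g [] (t .proj₁) (t .proj₂)) +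
      (∑[ s ∈ splits w ] ∑[ t ∈ splits (s .proj₂) ] g (c ∷ s .proj₁) (t .proj₁) (t .proj₂))
      ≈⟨ ∑-splits-∷ c w (λ α β → ∑[ t ∈ splits β ] g α (t .proj₁) (t .proj₂)) ⟨
    (∑[ s ∈ splits (c ∷ w) ] ∑[ t ∈ splits (s .proj₂) ] g (s .proj₁) (t .proj₁) (t .proj₂)) ∎

  ∑-unshuffles-∷ : ∀ (m : A) L (g : List A → List A → Carrier) →
    ∑[ s ∈ unshuffles (m ∷ L) ] g (s .proj₁) (s .proj₂) ≈
    (∑[ s ∈ unshuffles L ] g (m ∷ s .proj₁) (s .proj₂)) +
    (∑[ s ∈ unshuffles L ] g (s .proj₁) (m ∷ s .proj₂))
  ∑-unshuffles-∷ m L g = trans (∑-++ (map _ (unshuffles L)) _ _)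
    (+-cong (reflexive (∑-map _ (unshuffles L) _)) (reflexive (∑-map _ (unshuffles L) _)))

  -- Splitting an arrangement of L amounts to arranging the two halves of an
  -- unshuffle of L; inductively, m is inserted into one of the halves.
  ∑-permutations-splits : ∀ (L : List A) (g : List A → List A → Carrier) →
    ∑[ w ∈ permutations L ] ∑[ s ∈ splits w ] g (s .proj₁) (s .proj₂) ≈
    ∑[ u ∈ unshuffles L ] ∑[ α ∈ permutations (u .proj₁) ] ∑[ β ∈ permutations (u .proj₂) ] g α β
  ∑-permutations-splits []      g = +-congʳ (sym (+-identityʳ _))
  ∑-permutations-splits (m ∷ L) g = begin
    (∑[ w ∈ permutations (m ∷ L) ] ∑[ s ∈ splits w ] g (s .proj₁) (s .proj₂))
      ≈⟨ ∑-permutations-∷ m L (λ w → ∑[ s ∈ splits w ] g (s .proj₁) (s .proj₂)) ⟩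
    (∑[ w ∈ P L ] ∑[ s ∈ splits w ] ∑[ t ∈ splits (s .proj₁ ++ m ∷ s .proj₂) ] g (t .proj₁) (t .proj₂))
      ≈⟨ (∑-cong (P L) λ {w} _ → ∑-cong (splits w) λ {s} _ → ∑-splits-++ m (s .proj₁) (s .proj₂) g) ⟩
    (∑[ w ∈ P L ] ∑[ s ∈ splits w ]
      ((∑[ t ∈ splits (s .proj₁) ] g (t .proj₁) (t .proj₂ ++ m ∷ s .proj₂)) +
       (∑[ t ∈ splits (s .proj₂) ] g (s .proj₁ ++ m ∷ t .proj₁) (t .proj₂))))
      -- The insertion point of `m` and the cut divide `w` into three pieces. Regrouping makes the
      -- cut come first and the insertion of `m` into one half second; the exchange of summands puts
      -- the case of `m` in the left half first.
      ≈⟨ (∑-cong (P L) λ {w} _ → trans (∑-+ (splits w) _ _)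
           (trans (+-comm _ _)
             (+-cong (sym (∑-splits-assoc w λ α α′ β → g (α ++ m ∷ α′) β))
                     (∑-splits-assoc w λ α β β′ → g α (β ++ m ∷ β′))))) ⟩
    (∑[ w ∈ P L ]
      ((∑[ s ∈ splits w ] gˡ (s .proj₁) (s .proj₂)) + (∑[ s ∈ splits w ] gʳ (s .proj₁) (s .proj₂))))
      ≈⟨ ∑-+ (P L) _ _ ⟩
    (∑[ w ∈ P L ] ∑[ s ∈ splits w ] gˡ (s .proj₁) (s .proj₂)) +
    (∑[ w ∈ P L ] ∑[ s ∈ splits w ] gʳ (s .proj₁) (s .proj₂))
      ≈⟨ +-cong (∑-permutations-splits L gˡ) (∑-permutations-splits L gʳ) ⟩
    (∑[ u ∈ unshuffles L ] ∑[ α ∈ P (u .proj₁) ] ∑[ β ∈ P (u .proj₂) ] gˡ α β) +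
    (∑[ u ∈ unshuffles L ] ∑[ α ∈ P (u .proj₁) ] ∑[ β ∈ P (u .proj₂) ] gʳ α β)
      -- Arranging a half and then inserting `m` is arranging that half enlarged by `m`. On the
      -- left, the sum over insertion points must first move outside the sum over `β`.
      ≈⟨ +-cong
           (∑-cong (unshuffles L) λ {u} _ → trans
             (∑-cong (P (u .proj₁)) λ {α} _ → ∑-comm (P (u .proj₂)) (splits α) _)
             (sym (∑-permutations-∷ m (u .proj₁) (λ α → ∑[ β ∈ P (u .proj₂) ] g α β))))
           (∑-cong (unshuffles L) λ {u} _ → ∑-cong (P (u .proj₁)) λ {α} _ → sym (∑-permutations-∷ m (u .proj₂) (g α))) ⟩
    (∑[ u ∈ unshuffles L ] ∑[ α ∈ P (m ∷ u .proj₁) ] ∑[ β ∈ P (u .proj₂) ] g α β) +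
    (∑[ u ∈ unshuffles L ] ∑[ α ∈ P (u .proj₁) ] ∑[ β ∈ P (m ∷ u .proj₂) ] g α β)
      ≈⟨ ∑-unshuffles-∷ m L (λ A B → ∑[ α ∈ P A ] ∑[ β ∈ P B ] g α β) ⟨
    (∑[ u ∈ unshuffles (m ∷ L) ] ∑[ α ∈ P (u .proj₁) ] ∑[ β ∈ P (u .proj₂) ] g α β) ∎
    where
    P  = permutations
    gˡ = λ α β → ∑[ t ∈ splits α ] g (t .proj₁ ++ m ∷ t .proj₂) β
    gʳ = λ α β → ∑[ t ∈ splits β ] g α (t .proj₁ ++ m ∷ t .proj₂)

  -- The number of unshuffles with a left half of length `k` is a binomial coefficient: the head
  -- goes to the left or to the right half, which is Pascal's rule.
  ∑-unshuffles-lengths : ∀ (L : List A) (h : ℕ → ℕ → Carrier) →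
    ∑[ u ∈ unshuffles L ] h (length (u .proj₁)) (length (u .proj₂)) ≈
    ∑[ k ∈ upTo (suc (length L)) ] ((length L C k) · h k (length L ∸ k))
  ∑-unshuffles-lengths []      h = +-congʳ (sym (+-identityʳ _))
  ∑-unshuffles-lengths (m ∷ L) h = begin
    (∑[ u ∈ unshuffles (m ∷ L) ] h (length (u .proj₁)) (length (u .proj₂)))
      ≈⟨ ∑-unshuffles-∷ m L (λ α β → h (length α) (length β)) ⟩
    _ ≈⟨ +-cong (∑-unshuffles-lengths L (h ∘ suc)) (∑-unshuffles-lengths L λ k l → h k (suc l)) ⟩
    (∑[ k ∈ upTo (suc n) ] ((n C k) · h (suc k) (n ∸ k))) +
    (∑[ k ∈ upTo (suc n) ] ((n C k) · h k (suc (n ∸ k))))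
      -- Truncated subtraction makes this exchange of `suc` and `∸` depend on `k ≤ n`, which the
      -- range of summation provides.
      ≈⟨ +-congˡ (∑-cong (upTo (suc n)) λ {k} k∈ → reflexive
           (cong (λ l → (n C k) · h k l) (≡.sym (ℕ.+-∸-assoc 1 (ℕ.s≤s⁻¹ (∈-upTo⁻ k∈)))))) ⟩
    (∑[ k ∈ upTo (suc n) ] ((n C k) · h (suc k) (n ∸ k))) +
    (∑[ k ∈ upTo (suc n) ] ((n C k) · h k (suc n ∸ k)))
      ≈⟨ +-congˡ extend ⟩
    (∑[ k ∈ upTo (suc n) ] ((n C k) · h (suc k) (n ∸ k))) +
    (1 · h 0 (suc n) + (∑[ k ∈ upTo (suc n) ] ((n C suc k) · h (suc k) (n ∸ k))))
      ≈⟨ x∙yz≈y∙xz _ _ _ ⟩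
    1 · h 0 (suc n) +
    ((∑[ k ∈ upTo (suc n) ] ((n C k) · h (suc k) (n ∸ k))) +
     (∑[ k ∈ upTo (suc n) ] ((n C suc k) · h (suc k) (n ∸ k))))
      ≈⟨ +-congˡ (∑-+ (upTo (suc n)) _ _) ⟨
    1 · h 0 (suc n) +
    (∑[ k ∈ upTo (suc n) ] ((n C k) · h (suc k) (n ∸ k) + (n C suc k) · h (suc k) (n ∸ k)))
      ≈⟨ +-congˡ (∑-cong (upTo (suc n)) λ {k} _ → trans (sym (×-homo-+ (h (suc k) (n ∸ k)) (n C k) (n C suc k)))
           (×-congˡ (nCk+nC[k+1]≡[n+1]C[k+1] n k))) ⟩
    1 · h 0 (suc n) + (∑[ k ∈ upTo (suc n) ] ((suc n C suc k) · h (suc k) (n ∸ k)))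
      ≡⟨ ∑-upTo-suc (suc n) (λ k → (suc n C k) · h k (suc n ∸ k)) ⟨
    (∑[ k ∈ upTo (suc (suc n)) ] ((suc n C k) · h k (suc n ∸ k))) ∎
    where
    n = length L
    extend : ∑[ k ∈ upTo (suc n) ] ((n C k) · h k (suc n ∸ k)) ≈
             1 · h 0 (suc n) + (∑[ k ∈ upTo (suc n) ] ((n C suc k) · h (suc k) (n ∸ k)))
    extend = begin
      -- A term for `k = suc n` is adjoined, which vanishes because its binomial coefficient is 0;
      -- then the term for `k = 0` is split off, so that both sums run over the same values of `h`.
      (∑[ k ∈ upTo (suc n) ] e k)             ≈⟨ +-identityʳ _ ⟨
      (∑[ k ∈ upTo (suc n) ] e k) + 0#        ≡⟨ cong (λ b → ∑ (upTo (suc n)) e + b · h (suc n) (n ∸ n)) (k>n⇒nCk≡0 (ℕ.n<1+n n)) ⟨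
      (∑[ k ∈ upTo (suc n) ] e k) + e (suc n) ≈⟨ ∑-∷ʳ (upTo (suc n)) (suc n) e ⟨
      ∑ (upTo (suc n) List.∷ʳ suc n) e         ≡⟨ cong (λ ks → ∑ ks e) (List.upTo-∷ʳ (suc n)) ⟩
      (∑[ k ∈ upTo (suc (suc n)) ] e k)       ≡⟨ ∑-upTo-suc (suc n) e ⟩
      _                                       ∎
      where e = λ k → (n C k) · h k (suc n ∸ k)

-- The recurrence for arbitrary decreasing letter lists

module Recurrence {c ℓ} (R : CommutativeSemiring c ℓ)
                  (x : CommutativeSemiring.Carrier R) where
  open CommutativeSemiring R hiding (_≈_; _+_; _*_; 0#; 1#; Carrier; refl)
  open CommutativeSemiring R using () renaming (refl to ≈-refl)
  open Polynomials R
  open Sums R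
  open import Algebra.Properties.Semiring.Exp semiring using (^-homo-*; ^-congʳ)
  open import Relation.Binary.Reasoning.Setoid setoid

  G : List ℕ → Carrier
  G L = ∑[ w ∈ permutations L ] (x ^ borderSum [] w)

  F≈G-downFrom : ∀ n → F n x ≈ G (downFrom n)
  F≈G-downFrom n = begin
    (∑[ π ∈ 𝒮 n ] (x ^ lbsum π))                    ≈⟨ ∑-cong (𝒮 n) (λ {π} _ → ^-congʳ x (lbsum-letters π)) ⟩
    (∑[ π ∈ 𝒮 n ] (x ^ borderSum [] (letters π)))   ≡⟨ ∑-map letters (𝒮 n) _ ⟨
    (∑[ w ∈ map letters (𝒮 n) ] (x ^ borderSum [] w)) ≈⟨ ∑-↭ (letters-𝒮-↭ n) _ ⟩
    G (downFrom n)                                  ∎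

  -- Each arrangement is cut at `m`, and the cuts are grouped by the letter sets of the two sides.
  -- Within a group the exponent is a part from `α`, a part from `β` and a constant, so the double
  -- sum factors.
  G-∷ : ∀ {m L} → All (_< m) L → G (m ∷ L) ≈
    ∑[ u ∈ unshuffles L ] (G (u .proj₁) * G (u .proj₂) * x ^ (suc (length (u .proj₁)) ℕ.* length (u .proj₂)))
  G-∷ {m} {L} L<m = begin
    G (m ∷ L)
      ≈⟨ ∑-permutations-∷ m L (λ w → x ^ borderSum [] w) ⟩
    (∑[ w ∈ permutations L ] ∑[ s ∈ splits w ] (x ^ borderSum [] (s .proj₁ ++ m ∷ s .proj₂)))
      ≈⟨ ∑-permutations-splits L (λ α β → x ^ borderSum [] (α ++ m ∷ β)) ⟩
    (∑[ u ∈ unshuffles L ] ∑[ α ∈ permutations (u .proj₁) ] ∑[ β ∈ permutations (u .proj₂) ]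
      (x ^ borderSum [] (α ++ m ∷ β)))
      ≈⟨ ∑-cong (unshuffles L) (λ u∈ → let A⊆L , B⊆L = ∈-unshuffles⁻ u∈ in
           factor (All-resp-⊆ A⊆L L<m) (All-resp-⊆ B⊆L L<m)) ⟩
    _ ∎
    where
    term : ∀ {α β A B} → α ↭ A → β ↭ B → All (_< m) A → All (_< m) B →
      x ^ borderSum [] (α ++ m ∷ β) ≈
      x ^ borderSum [] α * (x ^ borderSum [] β * x ^ (suc (length A) ℕ.* length B))
    term {α} {β} {A} {B} α↭A β↭B A<m B<m = begin
      x ^ borderSum [] (α ++ m ∷ β)
        ≡⟨ cong (x ^_) (borderSum-max (All-resp-↭ (↭-sym α↭A) A<m) (All-resp-↭ (↭-sym β↭B) B<m)) ⟩
      x ^ (borderSum [] α ℕ.+ borderSum [] β ℕ.+ suc (length α) ℕ.* length β)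
        -- Written with the lengths of `A` and `B`, the last summand no longer varies with `α` and
        -- `β`, so its power can leave both sums.
        ≡⟨ cong₂ (λ k l → x ^ (borderSum [] α ℕ.+ borderSum [] β ℕ.+ suc k ℕ.* l))
             (↭-length α↭A) (↭-length β↭B) ⟩
      x ^ (borderSum [] α ℕ.+ borderSum [] β ℕ.+ suc (length A) ℕ.* length B)
        ≈⟨ ^-homo-* x (borderSum [] α ℕ.+ borderSum [] β) _ ⟩
      x ^ (borderSum [] α ℕ.+ borderSum [] β) * x ^ (suc (length A) ℕ.* length B)
        ≈⟨ *-congʳ (^-homo-* x (borderSum [] α) _) ⟩
      x ^ borderSum [] α * x ^ borderSum [] β * x ^ (suc (length A) ℕ.* length B)
        ≈⟨ *-assoc _ _ _ ⟩
      x ^ borderSum [] α * (x ^ borderSum [] β * x ^ (suc (length A) ℕ.* length B)) ∎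

    factor : ∀ {A B} → All (_< m) A → All (_< m) B →
      ∑[ α ∈ permutations A ] ∑[ β ∈ permutations B ] (x ^ borderSum [] (α ++ m ∷ β)) ≈
      G A * G B * x ^ (suc (length A) ℕ.* length B)
    factor {A} {B} A<m B<m = begin
      (∑[ α ∈ permutations A ] ∑[ β ∈ permutations B ] (x ^ borderSum [] (α ++ m ∷ β)))
        ≈⟨ ∑-cong (permutations A) (λ {α} α∈ → trans
             (∑-cong (permutations B) λ β∈ →
               term (∈-permutations⁻ α∈) (∈-permutations⁻ β∈) A<m B<m)
             (trans (∑-*ˡ (permutations B) _ _) (*-congˡ (∑-*ʳ (permutations B) _ _)))) ⟩
      (∑[ α ∈ permutations A ] (x ^ borderSum [] α * (G B * x ^ (suc (length A) ℕ.* length B))))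
        ≈⟨ ∑-*ʳ (permutations A) _ _ ⟩
      G A * (G B * x ^ (suc (length A) ℕ.* length B))
        ≈⟨ *-assoc _ _ _ ⟨
      G A * G B * x ^ (suc (length A) ℕ.* length B) ∎

  convolution : ℕ → Carrier
  convolution n = ∑[ k ∈ upTo (suc n) ] ((n C k) · (F k x * F (n ∸ k) x * x ^ (suc k ℕ.* (n ∸ k))))

  -- The halves of an unshuffle need not be intervals, so the recursion runs over
  -- arbitrary decreasing lists of letters and not just the lists downFrom n.
  G-convolution : ∀ {m L} → AllPairs ℕ._>_ (m ∷ L) →
    (∀ {A} → length A ≤ length L → AllPairs ℕ._>_ A → G A ≈ F (length A) x) →
    G (m ∷ L) ≈ convolution (length L)
  G-convolution {m} {L} (L<m ∷ L↓) ih = begin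
    G (m ∷ L)
      ≈⟨ G-∷ L<m ⟩
    _ ≈⟨ ∑-cong (unshuffles L) (λ u∈ → let A⊆L , B⊆L = ∈-unshuffles⁻ u∈ in
           *-congʳ (*-cong (ih (length-mono-≤ A⊆L) (AllPairs-resp-⊆ A⊆L L↓))
                           (ih (length-mono-≤ B⊆L) (AllPairs-resp-⊆ B⊆L L↓)))) ⟩
    _ ≈⟨ ∑-unshuffles-lengths L (λ k l → F k x * F l x * x ^ (suc k ℕ.* l)) ⟩
    convolution (length L) ∎

  downFrom-descending : ∀ n → AllPairs ℕ._>_ (downFrom n)
  downFrom-descending n = AllPairs.applyDownFrom⁺₁ id n λ j<i _ → j<i

  -- The recurrence is first proved conditionally, because the induction that establishes the
  -- hypothesis itself compares `G (m ∷ L)` with `F (suc (length L)) x` through their common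
  -- convolution.
  F-suc-if : ∀ n → (∀ {A} → length A ≤ n → AllPairs ℕ._>_ A → G A ≈ F (length A) x) →
             F (suc n) x ≈ convolution n
  F-suc-if n ih = begin
    F (suc n) x                       ≈⟨ F≈G-downFrom (suc n) ⟩
    G (downFrom (suc n))              ≈⟨ G-convolution (downFrom-descending (suc n))
                                           (λ A≤ → ih (subst (_ ≤_) (List.length-downFrom n) A≤)) ⟩
    convolution (length (downFrom n)) ≡⟨ cong convolution (List.length-downFrom n) ⟩
    convolution n                     ∎

  -- Only the relative order of the letters matters. This is strong induction on the length, with
  -- `n` as a bound: both sides equal the same convolution as soon as the claim holds for all
  -- decreasing lists no longer than the tail.
  G≈F-length : ∀ n {L} → length L ≤ n → AllPairs ℕ._>_ L → G L ≈ F (length L) x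
  G≈F-length _       {[]}    _          _  = ≈-refl
  G≈F-length (suc n) {m ∷ L} (s≤s L≤n) L↓ = trans (G-convolution L↓ ih) (sym (F-suc-if (length L) ih))
    where
    ih : ∀ {A} → length A ≤ length L → AllPairs ℕ._>_ A → G A ≈ F (length A) x
    ih A≤L = G≈F-length n (ℕ.≤-trans A≤L L≤n)

  F-suc : ∀ n → F (suc n) x ≈ convolution n
  F-suc n = F-suc-if n (G≈F-length n)

proposition2p2 : ∀ {c ℓ} (R : CommutativeSemiring c ℓ) →
    let open Polynomials R in
    (x : Carrier) →
    (F 0 x ≈ 1#) ×
    (∀ n → n ≥ 1 →
    F n x ≈ ∑[ k ∈ [1⋯ n ] ]
    (((n ∸ 1) C (k ∸ 1)) · (F (k ∸ 1) x * F (n ∸ k) x * x ^ (k ℕ.* (n ∸ k)))))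
-- The empty word is the only permutation for `n = 0`, so that sum is `1# + 0#`.
proposition2p2 R x = +-identityʳ 1# , λ { (suc n) _ → trans (F-suc n) (reflexive (reindex n)) }
  where
  open CommutativeSemiring R hiding (_≈_; _+_; _*_; 0#; 1#; Carrier; refl)
  open Polynomials R
  open Sums R
  open Recurrence R x
  summand : ℕ → ℕ → Carrier
  summand n k = ((n ∸ 1) C (k ∸ 1)) · (F (k ∸ 1) x * F (n ∸ k) x * x ^ (k ℕ.* (n ∸ k)))
  -- The index of `convolution` starts at 0 and that of the theorem at 1; the summand at `suc k`
  -- reduces to the term of `convolution` at `k`.
  reindex : ∀ n → convolution n ≡ ∑ [1⋯ suc n ] (summand (suc n))
  reindex n = ≡.trans (≡.sym (∑-map suc (upTo (suc n)) (summand (suc n))))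
    (cong (λ ks → ∑ ks (summand (suc n))) (List.map-upTo suc (suc n)))
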